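{- Let $f(x)=ax^2+bx+c$ with $a\in\mathbb{N}$ and $b,c\in\mathbb{Z}$, let $D=b^2-4ac$, and let \[ A_0=\left[\frac{|b|+(|D|+1)/2}{2a}\right]+1 . \] Then the sequence $\{\lambda(f(n))\}_{n=A_0}^{\infty}$ is either a constant sequence or it changes sign infinitely often.
   Context: $\mathbb{N}$ denotes the set of positive integers. $\lambda$ denotes the Liouville function: $\lambda(n)=(-1)^{\Omega(n)}$ for positive integers $n$, where $\Omega(n)$ is the number of prime factors of $n$ counted with multiplicity. $[x]$ denotes the greatest integer not exceeding $x$. A sequence with values in $\{+1,-1\}$ changes sign infinitely often if it takes each of the values $+1$ and $-1$ for infinitely many indices. -}

module Defs where

open import Data.Integer.Base as ℤ using
  (ℤ; +_; ∣_∣; Positive; positive; 0ℤ; 1ℤ; -1ℤ; _+_; _*_; _-_; _^_; _≤_; _<_)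
import Data.Integer.DivMod as ℤ
import Data.Integer.Properties as ℤ
open import Data.Integer.Tactic.RingSolver using (solve-∀)
open import Data.List.Base using (length)
open import Data.Nat.Base as ℕ using (ℕ; NonZero; suc)
import Data.Nat.Properties as ℕ
open import Data.Nat.Primality.Factorisation using (factors; factorise)
open import Data.Product.Base using (_×_; ∃-syntax)
open import Data.Rational.Unnormalised.Base as ℚᵘ using (ℚᵘ; floor)
open import Relation.Binary.PropositionalEquality

Ω : (n : ℕ) → .{{NonZero n}} → ℕ
Ω n = length (factors (factorise n))

liouville : (z : ℤ) → .{{Positive z}} → ℤ
liouville ℤ.+[1+ n ] = -1ℤ ^ Ω (suc n)

quadratic : ℕ → ℤ → ℤ → ℤ → ℤ
quadratic a b c x = + a * x ^ 2 + b * x + c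

discriminant : ℕ → ℤ → ℤ → ℤ
discriminant a b c = b ^ 2 - + 4 * + a * c

A₀ : (a : ℕ) → .{{NonZero a}} → ℤ → ℤ → ℤ
A₀ a b c = floor ((∣b∣ ℚᵘ.+ [∣D∣+1]/2) ℚᵘ.÷ 2a) + 1ℤ
  where
  ∣b∣ [∣D∣+1]/2 2a : ℚᵘ
  ∣b∣       = + ∣ b ∣ ℚᵘ./ 1
  [∣D∣+1]/2 = + (∣ discriminant a b c ∣ ℕ.+ 1) ℚᵘ./ 2
  2a        = + (2 ℕ.* a) ℚᵘ./ 1
  instance
    2a≢0 : NonZero (2 ℕ.* a)
    2a≢0 = ℕ.m*n≢0 2 a

private
  i≤∣i∣ : ∀ i → i ≤ + ∣ i ∣
  i≤∣i∣ (+ n)       = ℤ.≤-refl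
  i≤∣i∣ ℤ.-[1+ n ] = ℤ.-≤+

  -∣i∣≤i : ∀ i → ℤ.- (+ ∣ i ∣) ≤ i
  -∣i∣≤i i = subst (ℤ.- (+ ∣ i ∣) ≤_) (ℤ.neg-involutive i)
    (ℤ.neg-mono-≤ (subst (λ n → ℤ.- i ≤ + n) (ℤ.∣-i∣≡∣i∣ i) (i≤∣i∣ (ℤ.- i))))

  A₀-bound : ∀ a .{{_ : NonZero a}} b c →
    + 2 * + ∣ b ∣ + (+ ∣ discriminant a b c ∣ + 1ℤ) < + 4 * + a * A₀ a b c
  A₀-bound a@(suc a-1) b c = subst₂ _<_ lhs rhs (ℤ.n<s[n/ℕd]*d num den)
    where
    D = discriminant a b c
    num = (+ ∣ b ∣ * + 2 + + (∣ D ∣ ℕ.+ 1) * + 1) * + 1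
    den = 2 ℕ.* (2 ℕ.* a)

    lhs : num ≡ + 2 * + ∣ b ∣ + (+ ∣ D ∣ + 1ℤ)
    lhs = trans (cong (λ z → (+ ∣ b ∣ * + 2 + z * + 1) * + 1) (ℤ.pos-+ ∣ D ∣ 1))
                (identity (+ ∣ b ∣) (+ ∣ D ∣))
      where
      identity : ∀ x y → (x * + 2 + (y + 1ℤ) * + 1) * + 1 ≡ + 2 * x + (y + 1ℤ)
      identity = solve-∀

    +den : + den ≡ + 4 * + a
    +den = trans (cong +_ (sym (ℕ.*-assoc 2 2 a))) (ℤ.pos-* 4 a)

    rhs : ℤ.suc (num ℤ./ℕ den) * + den ≡ + 4 * + a * A₀ a b c
    rhs = trans (ℤ.*-comm (ℤ.suc (num ℤ./ℕ den)) (+ den)) (cong₂ _*_ +den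
      (trans (ℤ.+-comm 1ℤ (num ℤ./ℕ den))
             (cong (_+ 1ℤ) (sym (ℤ.div-pos-is-/ℕ num den)))))

  square-bound : ∀ d y → + ∣ d ∣ + 1ℤ < y → + 4 * d < y * y
  square-bound d (+ m) (ℤ.+<+ e<m) = ℤ.≤-<-trans
    (ℤ.*-monoˡ-≤-nonNeg (+ 4) (i≤∣i∣ d))
    (subst₂ _<_ (ℤ.pos-* 4 ∣ d ∣) (ℤ.pos-* m m) (ℤ.+<+ (ℕ.<-≤-trans 4e<s (ℕ.*-mono-≤ e<m e<m))))
    where
    e = ∣ d ∣
    s = suc (e ℕ.+ 1)
    4e<s : 4 ℕ.* e ℕ.< s ℕ.* s
    4e<s = subst (4 ℕ.* e ℕ.<_) (sym (identity e)) (ℕ.s≤s (ℕ.m≤m+n (4 ℕ.* e) (3 ℕ.+ e ℕ.* e)))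
      where
      open import Data.Nat.Tactic.RingSolver renaming (solve-∀ to solveℕ-∀)
      identity : ∀ e → suc (e ℕ.+ 1) ℕ.* suc (e ℕ.+ 1) ≡ suc (4 ℕ.* e ℕ.+ (3 ℕ.+ e ℕ.* e))
      identity = solveℕ-∀

quadratic-positive : ∀ a .{{_ : NonZero a}} b c k →
  Positive (quadratic a b c (A₀ a b c + + k))
quadratic-positive a@(suc _) b c k =
  positive (ℤ.*-cancelˡ-<-nonNeg 16a  (subst₂ _<_ (sym (ℤ.*-zeroʳ 16a)) (sym (16af (+ a) b c x))
    0<y²-4D))
  where
  x   = A₀ a b c + + k
  fx  = quadratic a b c x
  D   = discriminant a b c
  16a = + (16 ℕ.* a)
  y   = + 4 * + a * x + + 2 * b

  16af : ∀ a b c x → + 16 * a * (a * (x * (x * 1ℤ)) + b * x + c)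
       ≡ (+ 4 * a * x + + 2 * b) * (+ 4 * a * x + + 2 * b) - + 4 * (b * (b * 1ℤ) - + 4 * a * c)
  16af = solve-∀

  E+1<y : + ∣ D ∣ + 1ℤ < y
  E+1<y = subst (_< y) (identity (+ ∣ b ∣) (+ ∣ D ∣ + 1ℤ))
    (ℤ.+-mono-<-≤
      (ℤ.<-≤-trans (A₀-bound a b c) (ℤ.*-monoˡ-≤-nonNeg (+ (4 ℕ.* a)) (ℤ.i≤i+j (A₀ a b c) (+ k))))
      (ℤ.*-monoˡ-≤-nonNeg (+ 2) (-∣i∣≤i b)))
    where
    identity : ∀ p q → (+ 2 * p + q) + + 2 * (ℤ.- p) ≡ q
    identity = solve-∀

  0<y²-4D : 0ℤ < y * y - + 4 * D
  0<y²-4D = subst (_< y * y - + 4 * D) (ℤ.+-inverseʳ (+ 4 * D))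
    (ℤ.+-monoˡ-< (ℤ.- (+ 4 * D)) (square-bound D y E+1<y))

-- The sequence λ(f(n)), n ≥ A₀, reindexed from 0 by n = A₀ + k.
liouvilleSequence : (a : ℕ) → .{{NonZero a}} → ℤ → ℤ → ℕ → ℤ
liouvilleSequence a b c k =
  liouville (quadratic a b c (A₀ a b c + + k)) {{quadratic-positive a b c k}}

Constant : (ℕ → ℤ) → Set
Constant s = ∃[ v ] (∀ k → s k ≡ v)

InfinitelyOften : ℤ → (ℕ → ℤ) → Set
InfinitelyOften v s = ∀ N → ∃[ k ] (N ℕ.≤ k × s k ≡ v)

ChangesSignInfinitelyOften : (ℕ → ℤ) → Set
ChangesSignInfinitelyOften s = InfinitelyOften 1ℤ s × InfinitelyOften -1ℤ s

{-# OPTIONS --safe #-}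

-- Put X = 2ax + b, so that X² − 4a f(x) = D. If D = 0, then f(x) lies in the square class of a for
-- every x. If D ≠ 0 and n ≥ A₀, then 2X > |D| + 1, which prevents 4a f(n) from being a square, and a
-- solution of Pell's equation u² − 4a f(n) v² = 1 yields n′ > n with f(n′) = f(n) m². Hence every
-- value that the sequence takes is taken infinitely often.
-- Pell's equation is solved on Conway's river: from x² − d y², repeatedly replacing one basis vector
-- by the sum of both, so that the form stays positive on one and negative on the other, is a
-- reversible process on a finite set of forms, hence returns to x² − d y².
module Submission where

open import Defs
open import Algebra.Bundles using (module AbelianGroup)
open import Algebra.Properties.Group using (∙-cancelʳ)
open import Axiom.ExcludedMiddle using (ExcludedMiddle)
open import Data.Fin.Base using (Fin; fromℕ<; toℕ; combine)
open import Data.Fin.Properties using (pigeonhole; combine-injective; fromℕ<-injective)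
open import Data.Integer.Base as ℤ
  using (ℤ; +_; ∣_∣; Positive; positive; 0ℤ; 1ℤ; -1ℤ; _+_; _*_; _-_; -_; _^_; _≤_; _<_)
import Data.Integer.DivMod as ℤ
import Data.Integer.Properties as ℤ
open import Data.Integer.Tactic.RingSolver using (solve-∀)
open import Data.List.Base using (_++_)
open import Data.List.Properties using (length-++)
open import Data.List.Relation.Binary.Permutation.Propositional.Properties using (↭-length)
open import Data.List.Relation.Unary.All.Properties using (++⁺)
open import Data.Nat.Base as ℕ using (ℕ; NonZero; zero; suc; z≤n; s≤s)
open import Data.Nat.GeneralisedArithmetic using (fold)
open import Data.Nat.ListAction.Properties using (product-++)
open import Data.Nat.Primality.Factorisation
  using (PrimeFactorisation; factorise; factorisationUnique)
import Data.Nat.Properties as ℕ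
open import Data.Product.Base using (_×_; _,_; ∃₂; ∃-syntax; -,_)
open import Data.Sum.Base using (_⊎_; inj₁; inj₂; [_,_]′)
open import Function.Base using (_∘_)
open import Level using (0ℓ)
open import Relation.Binary.PropositionalEquality
open import Relation.Nullary using (yes; no; contradiction; ¬_)
open import Relation.Nullary.Decidable using (decidable-stable)

-- The Liouville function: complete multiplicativity and square factors.

-- Concatenating prime factorisations of m and n factorises m n, and by uniqueness this list is a
-- permutation of the one that `Ω` counts.
Ω-* : ∀ m n .{{_ : NonZero m}} .{{_ : NonZero n}} .{{_ : NonZero (m ℕ.* n)}} →
  Ω (m ℕ.* n) ≡ Ω m ℕ.+ Ω n
Ω-* m n = trans (↭-length (factorisationUnique (factorise (m ℕ.* n)) product-factorisation))
                (length-++ (factors M))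
  where
  open PrimeFactorisation
  M = factorise m
  N = factorise n
  product-factorisation : PrimeFactorisation (m ℕ.* n)
  product-factorisation = record
    { factors         = factors M ++ factors N
    ; isFactorisation = trans (cong₂ ℕ._*_ (isFactorisation M) (isFactorisation N))
                              (sym (product-++ (factors M) (factors N)))
    ; factorsPrime    = ++⁺ (factorsPrime M) (factorsPrime N)
    }

-1^n≡±1 : ∀ n → -1ℤ ^ n ≡ 1ℤ ⊎ -1ℤ ^ n ≡ -1ℤ
-1^n≡±1 zero    = inj₁ refl
-1^n≡±1 (suc n) with -1^n≡±1 n
... | inj₁ eq = inj₂ (cong (-1ℤ *_) eq)
... | inj₂ eq = inj₁ (cong (-1ℤ *_) eq)

-1^[n+n]≡1 : ∀ n → -1ℤ ^ (n ℕ.+ n) ≡ 1ℤ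
-1^[n+n]≡1 n rewrite ℤ.^-distribˡ-+-* -1ℤ n n with -1^n≡±1 n
... | inj₁ eq = cong₂ _*_ eq eq
... | inj₂ eq = cong₂ _*_ eq eq

liouville≡±1 : ∀ z .{{_ : Positive z}} → liouville z ≡ 1ℤ ⊎ liouville z ≡ -1ℤ
liouville≡±1 ℤ.+[1+ n ] = -1^n≡±1 (Ω (suc n))

-- Positivity proofs are irrelevant, so the two sides may carry unrelated ones; a plain `cong` could
-- not change the argument together with its proof.
liouville-cong : ∀ {y z} .{{_ : Positive y}} .{{_ : Positive z}} → y ≡ z →
  liouville y ≡ liouville z
liouville-cong refl = refl

z*z≡∣z∣*∣z∣ : ∀ z → z * z ≡ + (∣ z ∣ ℕ.* ∣ z ∣)
z*z≡∣z∣*∣z∣ ℤ.+0       = refl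
z*z≡∣z∣*∣z∣ ℤ.+[1+ _ ] = refl
z*z≡∣z∣*∣z∣ ℤ.-[1+ _ ] = refl

-- The factor z² contributes 2 Ω(|z|) prime factors, an even number.
liouville-square : ∀ y z .{{_ : Positive y}} .{{_ : Positive (y * (z * z))}} →
  liouville (y * (z * z)) ≡ liouville y
liouville-square y@(ℤ.+[1+ n ]) z {{p}} {{q}} = helper ∣ z ∣ (z*z≡∣z∣*∣z∣ z)
  where
  open ≡-Reasoning
  helper : ∀ m → z * z ≡ + (m ℕ.* m) → liouville (y * (z * z)) {{q}} ≡ liouville y
  -- Here z = 0, which the positivity of y z² excludes.
  helper zero eq = contradiction (trans (cong (y *_) eq) (ℤ.*-zeroʳ y))
    (ℤ.<⇒≢ (ℤ.positive⁻¹ _ {{q}}) ∘ sym)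
  helper m@(suc _) eq = begin
    liouville (y * (z * z)) {{q}}          ≡⟨ liouville-cong {{q}} (cong (y *_) eq) ⟩
    -1ℤ ^ Ω (suc n ℕ.* (m ℕ.* m))          ≡⟨ cong (-1ℤ ^_) (Ω-* (suc n) (m ℕ.* m)) ⟩
    -1ℤ ^ (Ω (suc n) ℕ.+ Ω (m ℕ.* m))      ≡⟨ ℤ.^-distribˡ-+-* -1ℤ (Ω (suc n)) _ ⟩
    -1ℤ ^ Ω (suc n) * -1ℤ ^ Ω (m ℕ.* m)    ≡⟨ cong (λ k → -1ℤ ^ Ω (suc n) * -1ℤ ^ k) (Ω-* m m) ⟩
    -1ℤ ^ Ω (suc n) * -1ℤ ^ (Ω m ℕ.+ Ω m)  ≡⟨ cong (-1ℤ ^ Ω (suc n) *_) (-1^[n+n]≡1 (Ω m)) ⟩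
    -1ℤ ^ Ω (suc n) * 1ℤ                   ≡⟨ ℤ.*-identityʳ _ ⟩
    -1ℤ ^ Ω (suc n)                        ∎

-- Integer inequalities and an encoding of bounded integers in a finite set.

0<i*j : ∀ {i j} → 0ℤ < i → 0ℤ < j → 0ℤ < i * j
0<i*j {i} {j} 0<i 0<j =
  subst (_< i * j) (ℤ.*-zeroʳ i) (ℤ.*-monoˡ-<-pos i {{positive 0<i}} 0<j)

m≤m*m : ∀ m → m ℕ.≤ m ℕ.* m
m≤m*m zero      = z≤n
m≤m*m m@(suc _) = ℕ.m≤m*n m m

-- This is (m - 1)(n - 1) ≥ 0 expanded.
m+n≤1+m*n : ∀ m n .{{_ : NonZero m}} .{{_ : NonZero n}} → m ℕ.+ n ℕ.≤ suc (m ℕ.* n)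
m+n≤1+m*n (suc m) (suc n) = s≤s (begin
  m ℕ.+ suc n             ≡⟨ ℕ.+-comm m (suc n) ⟩
  suc n ℕ.+ m             ≤⟨ ℕ.+-monoʳ-≤ (suc n) (ℕ.m≤m*n m (suc n)) ⟩
  suc n ℕ.+ m ℕ.* suc n   ∎)
  where open ℕ.≤-Reasoning

0≤i+∣i∣ : ∀ i → 0ℤ ≤ i + + ∣ i ∣
0≤i+∣i∣ (+ _)        = ℤ.+≤+ z≤n
0≤i+∣i∣ ℤ.-[1+ n ] = ℤ.≤-reflexive (sym (ℤ.n⊖n≡0 (suc n)))

module Window (N : ℕ) where

  -- The shift by N carries the interval from -N to N onto 0, ..., 2N, where taking absolute values
  -- loses nothing.
  encode : ∀ i → ∣ i ∣ ℕ.≤ N → Fin (suc (N ℕ.+ N))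
  encode i ∣i∣≤N = fromℕ< (s≤s (ℕ.≤-trans (ℤ.∣i+j∣≤∣i∣+∣j∣ i (+ N)) (ℕ.+-monoˡ-≤ N ∣i∣≤N)))

  0≤i+N : ∀ i → ∣ i ∣ ℕ.≤ N → 0ℤ ≤ i + + N
  0≤i+N i ∣i∣≤N = ℤ.≤-trans (0≤i+∣i∣ i) (ℤ.+-monoʳ-≤ i (ℤ.+≤+ ∣i∣≤N))

  encode-injective : ∀ {i j} i≤ j≤ → encode i i≤ ≡ encode j j≤ → i ≡ j
  encode-injective {i} {j} i≤ j≤ eq = ∙-cancelʳ (AbelianGroup.group ℤ.+-0-abelianGroup) _ i j (begin
    i + + N        ≡⟨ ℤ.0≤i⇒+∣i∣≡i (0≤i+N i i≤) ⟨
    + ∣ i + + N ∣  ≡⟨ cong +_ (fromℕ<-injective _ _ _ _ eq) ⟩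
    + ∣ j + + N ∣  ≡⟨ ℤ.0≤i⇒+∣i∣≡i (0≤i+N j j≤) ⟩
    j + + N        ∎)
    where open ≡-Reasoning

-- Pell's equation by a walk along Conway's river.

module Pell (d : ℕ) (nonsquare : ∀ z → z * z ≢ + d) where

  open Window d

  -- The indefinite binary form A x² + 2h xy − c y².
  record Form : Set where
    constructor form
    field A h c : ℤ

  open Form

  form-cong : ∀ {A A′ h h′ c c′} → A ≡ A′ → h ≡ h′ → c ≡ c′ → form A h c ≡ form A′ h′ c′
  form-cong refl refl refl = refl

  -- The values of the form at the sum and at the difference of its two basis vectors.
  mid pre-mid : Form → ℤ
  mid     f = A f + + 2 * h f - c f
  pre-mid f = A f - + 2 * h f - c f

  -- The sum of the basis vectors replaces the first vector if the form is positive there, and the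
  -- second otherwise.
  step : Form → Form
  step f with 0ℤ ℤ.<? mid f
  ... | yes _ = form (mid f) (h f - c f) (c f)
  ... | no  _ = form (A f) (h f + A f) (- mid f)

  unstep : Form → Form
  unstep f with 0ℤ ℤ.<? pre-mid f
  ... | yes _ = form (pre-mid f) (h f + c f) (c f)
  ... | no  _ = form (A f) (h f - A f) (- pre-mid f)

  -- The form is positive on the first basis vector and negative on the second; `disc` is a quarter
  -- of its usual discriminant.
  record Reduced (f : Form) : Set where
    field
      A>0  : 0ℤ < A f
      c>0  : 0ℤ < c f
      disc : h f * h f + A f * c f ≡ + d

  open Reduced

  -- If the form vanished at the sum, then A = c - 2h and d = h² + A c = (h - c)² would be a square.
  mid≢0 : ∀ {f} → Reduced f → mid f ≢ 0ℤ
  mid≢0 {f} R mid≡0 = nonsquare (h f - c f) (begin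
    (h f - c f) * (h f - c f)            ≡⟨ identity (A f) (h f) (c f) ⟩
    (h f * h f + A f * c f) - mid f * c f ≡⟨ cong₂ (λ x y → x - y * c f) (disc R) mid≡0 ⟩
    + d - 0ℤ                             ≡⟨ ℤ.+-identityʳ (+ d) ⟩
    + d                                  ∎)
    where
    open ≡-Reasoning
    identity : ∀ A h c → (h - c) * (h - c) ≡ (h * h + A * c) - (A + + 2 * h - c) * c
    identity = solve-∀

  ≮∧≢⇒-> : ∀ {i} → ¬ 0ℤ < i → i ≢ 0ℤ → 0ℤ < - i
  ≮∧≢⇒-> 0≮i i≢0 = ℤ.neg-mono-< (ℤ.≤∧≢⇒< (ℤ.≮⇒≥ 0≮i) i≢0)

  -- The change of basis has determinant 1 and so preserves the discriminant; `mid≢0` makes the new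
  -- second value strictly negative.
  step-reduced : ∀ {f} → Reduced f → Reduced (step f)
  step-reduced {f} R with 0ℤ ℤ.<? mid f
  ... | yes mid>0 = record
    { A>0 = mid>0 ; c>0 = c>0 R ; disc = trans (identity (A f) (h f) (c f)) (disc R) }
    where
    identity : ∀ A h c → (h - c) * (h - c) + (A + + 2 * h - c) * c ≡ h * h + A * c
    identity = solve-∀
  ... | no mid≯0 = record
    { A>0 = A>0 R ; c>0 = ≮∧≢⇒-> mid≯0 (mid≢0 R)
    ; disc = trans (identity (A f) (h f) (c f)) (disc R) }
    where
    identity : ∀ A h c → (h + A) * (h + A) + A * - (A + + 2 * h - c) ≡ h * h + A * c
    identity = solve-∀

  unstep-pos : ∀ {f} → 0ℤ < pre-mid f → unstep f ≡ form (pre-mid f) (h f + c f) (c f)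
  unstep-pos {f} 0<w with 0ℤ ℤ.<? pre-mid f
  ... | yes _   = refl
  ... | no 0≮w = contradiction 0<w 0≮w

  unstep-neg : ∀ {f} → pre-mid f < 0ℤ → unstep f ≡ form (A f) (h f - A f) (- pre-mid f)
  unstep-neg {f} w<0 with 0ℤ ℤ.<? pre-mid f
  ... | yes 0<w = contradiction 0<w (ℤ.<-asym w<0)
  ... | no _    = refl

  -- The difference of the new vectors is the old first vector, of value A > 0, if the first one was
  -- replaced, and minus the old second vector, of value -c < 0, otherwise. Hence the sign of
  -- `pre-mid` reveals which move was made.
  unstep∘step : ∀ {f} → Reduced f → unstep (step f) ≡ f
  unstep∘step {f} R with 0ℤ ℤ.<? mid f
  ... | yes _ = trans (unstep-pos (subst (0ℤ <_) (sym w≡A) (A>0 R)))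
                      (form-cong w≡A (h-c+c (h f) (c f)) refl)
    where
    identity : ∀ A h c → (A + + 2 * h - c) - + 2 * (h - c) - c ≡ A
    identity = solve-∀
    h-c+c : ∀ h c → h - c + c ≡ h
    h-c+c = solve-∀
    w≡A = identity (A f) (h f) (c f)
  ... | no _ = trans (unstep-neg (subst (_< 0ℤ) (sym w≡-c) (ℤ.neg-mono-< (c>0 R))))
                     (form-cong refl (h+A-A (h f) (A f)) (trans (cong -_ w≡-c) (ℤ.neg-involutive (c f))))
    where
    identity : ∀ A h c → A - + 2 * (h + A) - - (A + + 2 * h - c) ≡ - c
    identity = solve-∀
    h+A-A : ∀ h A → h + A - A ≡ h
    h+A-A = solve-∀
    w≡-c = identity (A f) (h f) (c f)

  d>0 : 0ℤ < + d
  d>0 = ℤ.≤∧≢⇒< (ℤ.+≤+ z≤n) (nonsquare 0ℤ)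

  orbit : ℕ → Form
  orbit = fold (form 1ℤ 0ℤ (+ d)) step

  orbit-reduced : ∀ n → Reduced (orbit n)
  orbit-reduced zero    = record
    { A>0 = ℤ.+<+ (s≤s z≤n) ; c>0 = d>0 ; disc = trans (ℤ.+-identityˡ _) (ℤ.*-identityˡ (+ d)) }
  orbit-reduced (suc n) = step-reduced (orbit-reduced n)

  module _ {f} (R : Reduced f) where

    private
      instance
        A≢0 : NonZero ∣ A f ∣
        A≢0 = ℤ.>-nonZero (A>0 R)
        c≢0 : NonZero ∣ c f ∣
        c≢0 = ℤ.>-nonZero (c>0 R)

    -- With A and c positive, d is a sum of nonnegative terms, so it bounds |h|, A and c; this makes
    -- the set of reduced forms finite.
    ∣disc∣ : ∣ h f ∣ ℕ.* ∣ h f ∣ ℕ.+ ∣ A f ∣ ℕ.* ∣ c f ∣ ≡ d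
    ∣disc∣ = ℤ.+-injective (begin
      + (∣ h f ∣ ℕ.* ∣ h f ∣) + + (∣ A f ∣ ℕ.* ∣ c f ∣)
        ≡⟨ cong₂ _+_ (sym (z*z≡∣z∣*∣z∣ (h f))) (ℤ.pos-* ∣ A f ∣ ∣ c f ∣) ⟩
      h f * h f + + ∣ A f ∣ * + ∣ c f ∣
        ≡⟨ cong₂ (λ x y → h f * h f + x * y) (ℤ.0≤i⇒+∣i∣≡i (ℤ.<⇒≤ (A>0 R)))
                                             (ℤ.0≤i⇒+∣i∣≡i (ℤ.<⇒≤ (c>0 R))) ⟩
      h f * h f + A f * c f
        ≡⟨ disc R ⟩
      + d ∎)
      where open ≡-Reasoning

    ∣h∣≤d : ∣ h f ∣ ℕ.≤ d
    ∣h∣≤d = subst (∣ h f ∣ ℕ.≤_) ∣disc∣ (ℕ.≤-trans (m≤m*m ∣ h f ∣) (ℕ.m≤m+n _ _))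

    ∣A∣≤d : ∣ A f ∣ ℕ.≤ d
    ∣A∣≤d = subst (∣ A f ∣ ℕ.≤_) ∣disc∣ (ℕ.≤-trans (ℕ.m≤m*n ∣ A f ∣ ∣ c f ∣) (ℕ.m≤n+m _ _))

    ∣c∣≤d : ∣ c f ∣ ℕ.≤ d
    ∣c∣≤d = subst (∣ c f ∣ ℕ.≤_) ∣disc∣ (ℕ.≤-trans (ℕ.m≤n*m ∣ c f ∣ ∣ A f ∣) (ℕ.m≤n+m _ _))

    code : Fin (suc (d ℕ.+ d) ℕ.* (suc (d ℕ.+ d) ℕ.* suc (d ℕ.+ d)))
    code = combine (encode (A f) ∣A∣≤d) (combine (encode (h f) ∣h∣≤d) (encode (c f) ∣c∣≤d))

  code-injective : ∀ {f g} (R : Reduced f) (S : Reduced g) → code R ≡ code S → f ≡ g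
  code-injective R S eq =
    let eqA , eqhc = combine-injective _ _ _ _ eq
        eqh , eqc  = combine-injective _ _ _ _ eqhc
    in form-cong (encode-injective (∣A∣≤d R) (∣A∣≤d S) eqA)
                 (encode-injective (∣h∣≤d R) (∣h∣≤d S) eqh)
                 (encode-injective (∣c∣≤d R) (∣c∣≤d S) eqc)

  -- Since `step` is invertible along the orbit, a repetition can be moved back to the start: there
  -- is no preperiod.
  orbit-cancel : ∀ m k → orbit m ≡ orbit (m ℕ.+ k) → orbit 0 ≡ orbit k
  orbit-cancel zero    k eq = eq
  orbit-cancel (suc m) k eq = orbit-cancel m k (begin
    orbit m                       ≡⟨ unstep∘step (orbit-reduced m) ⟨
    unstep (orbit (suc m))        ≡⟨ cong unstep eq ⟩
    unstep (orbit (suc m ℕ.+ k))  ≡⟨ unstep∘step (orbit-reduced (m ℕ.+ k)) ⟩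
    orbit (m ℕ.+ k)               ∎)
    where open ≡-Reasoning

  orbit-periodic : ∃[ k ] orbit 0 ≡ orbit (suc k)
  orbit-periodic =
    let i , j , i<j , eq = pigeonhole (ℕ.n<1+n _) (λ i → code (orbit-reduced (toℕ i)))
        -- The strict inequality i < j yields a gap of the form `suc k`, that is, a positive period.
        k , i+1+k≡j = ℕ.m≤n⇒∃[o]m+o≡n i<j
    in k , orbit-cancel (toℕ i) (suc k)
      (trans (code-injective (orbit-reduced (toℕ i)) (orbit-reduced (toℕ j)) eq)
             (cong orbit (trans (sym i+1+k≡j) (sym (ℕ.+-suc (toℕ i) k)))))

  -- (p , q) and (r , s) are the basis vectors in which x² − d y² becomes f after n steps.
  -- Until the first vector moves, the polar coefficient h grows by 1 at every step.
  record Basis (n : ℕ) (f : Form) : Set where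
    field
      {p q r s} : ℤ
      A≡        : A f ≡ p * p - + d * (q * q)
      h≡        : h f ≡ p * r - + d * (q * s)
      c≡        : c f ≡ + d * (s * s) - r * r
      p>0       : 0ℤ < p
      r≥0       : 0ℤ ≤ r
      s>0       : 0ℤ < s
      moved     : 0ℤ < q ⊎ q ≡ 0ℤ × A f ≡ 1ℤ × h f ≡ + n

  open Basis

  q≥0 : ∀ {n f} (B : Basis n f) → 0ℤ ≤ q B
  q≥0 B = [ ℤ.<⇒≤ , (λ (q≡0 , _) → ℤ.≤-reflexive (sym q≡0)) ]′ (moved B)

  mid≡ : ∀ {n f} (B : Basis n f) →
    mid f ≡ (p B + r B) * (p B + r B) - + d * ((q B + s B) * (q B + s B))
  mid≡ B = trans (cong₂ _-_ (cong₂ (λ x y → x + + 2 * y) (A≡ B) (h≡ B)) (c≡ B))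
                 (identity (+ d) (p B) (q B) (r B) (s B))
    where
    identity : ∀ D p q r s →
      (p * p - D * (q * q)) + + 2 * (p * r - D * (q * s)) - (D * (s * s) - r * r)
      ≡ (p + r) * (p + r) - D * ((q + s) * (q + s))
    identity = solve-∀

  step-basis : ∀ {n f} → Basis n f → Basis (suc n) (step f)
  step-basis {n} {f} B@record { p = p ; q = q ; r = r ; s = s } with 0ℤ ℤ.<? mid f
  ... | yes _ = record
    { p     = p + r
    ; q     = q + s
    ; r     = r
    ; s     = s
    ; A≡    = mid≡ B
    ; h≡    = trans (cong₂ _-_ (h≡ B) (c≡ B)) (identity (+ d) p q r s)
    ; c≡    = c≡ B
    ; p>0   = ℤ.+-mono-<-≤ (p>0 B) (r≥0 B)
    ; r≥0   = r≥0 B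
    ; s>0   = s>0 B
    ; moved = inj₁ (ℤ.+-mono-≤-< (q≥0 B) (s>0 B))
    }
    where
    identity : ∀ D p q r s → (p * r - D * (q * s)) - (D * (s * s) - r * r)
                           ≡ (p + r) * r - D * ((q + s) * s)
    identity = solve-∀
  ... | no _ = record
    { p     = p
    ; q     = q
    ; r     = p + r
    ; s     = q + s
    ; A≡    = A≡ B
    ; h≡    = trans (cong₂ _+_ (h≡ B) (A≡ B)) (identity (+ d) p q r s)
    ; c≡    = trans (cong -_ (mid≡ B)) (negate (+ d) (p + r) (q + s))
    ; p>0   = p>0 B
    ; r≥0   = ℤ.<⇒≤ (ℤ.+-mono-<-≤ (p>0 B) (r≥0 B))
    ; s>0   = ℤ.+-mono-≤-< (q≥0 B) (s>0 B)
    ; moved = [ inj₁ , (λ (q≡0 , A≡1 , h≡n) → inj₂ (q≡0 , A≡1 ,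
                  trans (cong₂ _+_ h≡n A≡1) (ℤ.+-comm (+ n) 1ℤ))) ]′ (moved B)
    }
    where
    identity : ∀ D p q r s → (p * r - D * (q * s)) + (p * p - D * (q * q))
                           ≡ p * (p + r) - D * (q * (q + s))
    identity = solve-∀
    negate : ∀ D x y → - (x * x - D * (y * y)) ≡ D * (y * y) - x * x
    negate = solve-∀

  orbit-basis : ∀ n → Basis n (orbit n)
  orbit-basis zero    = record
    { p     = 1ℤ
    ; q     = 0ℤ
    ; r     = 0ℤ
    ; s     = 1ℤ
    ; A≡    = A≡′ (+ d)
    ; h≡    = h≡′ (+ d)
    ; c≡    = c≡′ (+ d)
    ; p>0   = ℤ.+<+ (s≤s z≤n)
    ; r≥0   = ℤ.≤-refl
    ; s>0   = ℤ.+<+ (s≤s z≤n)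
    ; moved = inj₂ (refl , refl , refl)
    }
    where
    A≡′ : ∀ D → 1ℤ ≡ 1ℤ * 1ℤ - D * (0ℤ * 0ℤ)
    A≡′ = solve-∀
    h≡′ : ∀ D → 0ℤ ≡ 1ℤ * 0ℤ - D * (0ℤ * 1ℤ)
    h≡′ = solve-∀
    c≡′ : ∀ D → D ≡ D * (1ℤ * 1ℤ) - 0ℤ * 0ℤ
    c≡′ = solve-∀
  orbit-basis (suc n) = step-basis (orbit-basis n)

  -- Positivity excludes the trivial solution (1, 0) and later makes the translation t positive.
  PellSolution : Set
  PellSolution = ∃₂ λ u v → 0ℤ < u × 0ℤ < v × u * u ≡ 1ℤ + + d * (v * v)

  -- The form x² - d y² has A = 1, so the first basis vector (p, q) has norm 1; it remains to see
  -- that q > 0.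
  principal-basis⇒solution : ∀ {n} → Basis (suc n) (orbit 0) → PellSolution
  principal-basis⇒solution B@record { p = p ; q = q } with moved B
  ... | inj₁ q>0 = p , q , p>0 B , q>0 , (begin
    p * p                                       ≡⟨ identity (p * p) (+ d * (q * q)) ⟩
    (p * p - + d * (q * q)) + + d * (q * q)     ≡⟨ cong (_+ + d * (q * q)) (A≡ B) ⟨
    1ℤ + + d * (q * q)                          ∎)
    where
    open ≡-Reasoning
    identity : ∀ x y → x ≡ (x - y) + y
    identity = solve-∀
  -- A first vector that never moved would give h = n + 1, but the starting form has h = 0.
  ... | inj₂ (_ , _ , ())

  pell : PellSolution
  pell = let k , period = orbit-periodic in
    principal-basis⇒solution (subst (Basis (suc k)) (sym period) (orbit-basis (suc k)))

-- The quadratic polynomial: factoring D, translation by a unit, and the bound at `A₀`.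

-- The two factors X − z and X + z of D are nonzero and add up to 2X.
∣2X∣≤1+∣D∣ : ∀ {D} X z → D ≢ 0ℤ → X * X - z * z ≡ D → ∣ + 2 * X ∣ ℕ.≤ suc ∣ D ∣
∣2X∣≤1+∣D∣ {D} X z D≢0 eq = begin
  ∣ + 2 * X ∣                           ≡⟨ cong ∣_∣ (sum X z) ⟩
  ∣ (X - z) + (X + z) ∣                 ≤⟨ ℤ.∣i+j∣≤∣i∣+∣j∣ (X - z) (X + z) ⟩
  ∣ X - z ∣ ℕ.+ ∣ X + z ∣               ≤⟨ m+n≤1+m*n ∣ X - z ∣ ∣ X + z ∣ ⟩
  suc (∣ X - z ∣ ℕ.* ∣ X + z ∣)         ≡⟨ cong suc (ℤ.abs-* (X - z) (X + z)) ⟨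
  suc ∣ (X - z) * (X + z) ∣             ≡⟨ cong (suc ∘ ∣_∣) factored ⟩
  suc ∣ D ∣                             ∎
  where
  open ℕ.≤-Reasoning
  sum : ∀ X z → + 2 * X ≡ (X - z) + (X + z)
  sum = solve-∀
  difference : ∀ X z → (X - z) * (X + z) ≡ X * X - z * z
  difference = solve-∀
  factored : (X - z) * (X + z) ≡ D
  factored = trans (difference X z) eq
  instance
    X-z≢0 : NonZero ∣ X - z ∣
    X-z≢0 = ℤ.≢-nonZero λ X-z≡0 → D≢0 (trans (sym factored) (cong (_* (X + z)) {x = X - z} X-z≡0))
    X+z≢0 : NonZero ∣ X + z ∣
    X+z≢0 = ℤ.≢-nonZero λ X+z≡0 → D≢0 (trans (sym factored)
      (trans (cong ((X - z) *_) {x = X + z} X+z≡0) (ℤ.*-zeroʳ (X - z))))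

derivative : ℕ → ℤ → ℤ → ℤ
derivative a b x = + 2 * + a * x + b

derivative²-4af≡D : ∀ a b c x →
  derivative a b x * derivative a b x - + 4 * + a * quadratic a b c x ≡ discriminant a b c
derivative²-4af≡D a = identity (+ a)
  where
  identity : ∀ a b c x →
    (+ 2 * a * x + b) * (+ 2 * a * x + b) - + 4 * a * (a * (x * (x * 1ℤ)) + b * x + c)
    ≡ b * (b * 1ℤ) - + 4 * a * c
  identity = solve-∀

-- The Taylor expansion at x, exact in degree two; it gives f(x + t) the shape treated by
-- `translate-by-unit`.
quadratic-translate : ∀ a b c x t →
  quadratic a b c (x + t) ≡ quadratic a b c x + derivative a b x * t + + a * (t * t)
quadratic-translate a = identity (+ a)
  where
  identity : ∀ a b c x t → a * ((x + t) * ((x + t) * 1ℤ)) + b * (x + t) + c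
                         ≡ (a * (x * (x * 1ℤ)) + b * x + c) + (+ 2 * a * x + b) * t + a * (t * t)
  identity = solve-∀

-- With X = f′(x) and l = f(x), the unit (u + v√(4al))² of norm 1 moves the solution (X , 1) of
-- X² − 4al m² = D to (X + 2at , m), where t = 4lv(vX + u) and m = 1 + 2v(uX + 4alv).
translate-by-unit : ∀ a l X u v → u * u ≡ 1ℤ + + 4 * a * l * (v * v) →
  let t = + 4 * l * v * (v * X + u)
      m = 1ℤ + + 2 * v * (u * X + + 4 * a * l * v)
  in l + X * t + a * (t * t) ≡ l * (m * m)
translate-by-unit a l X u v unit = begin
  l + X * t + a * (t * t)
    ≡⟨ identity a l X u v ⟩
  l * (m * m) + K * (1ℤ + + 4 * a * l * (v * v) - u * u)
    ≡⟨ cong (λ w → l * (m * m) + K * (1ℤ + + 4 * a * l * (v * v) - w)) unit ⟩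
  l * (m * m) + K * (1ℤ + + 4 * a * l * (v * v) - (1ℤ + + 4 * a * l * (v * v)))
    ≡⟨ cancel (l * (m * m)) K (1ℤ + + 4 * a * l * (v * v)) ⟩
  l * (m * m) ∎
  where
  open ≡-Reasoning
  t = + 4 * l * v * (v * X + u)
  m = 1ℤ + + 2 * v * (u * X + + 4 * a * l * v)
  -- The two sides differ, for arbitrary u and v, by a multiple of 1 + 4alv² - u²; K is the
  -- cofactor.
  K = + 4 * l * (v * v) * (X * X - + 4 * a * l)
  cancel : ∀ x y z → x + y * (z - z) ≡ x
  cancel = solve-∀
  identity : ∀ a l X u v →
    l + X * (+ 4 * l * v * (v * X + u)) + a * ((+ 4 * l * v * (v * X + u)) * (+ 4 * l * v * (v * X + u)))
    ≡ l * ((1ℤ + + 2 * v * (u * X + + 4 * a * l * v)) * (1ℤ + + 2 * v * (u * X + + 4 * a * l * v)))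
      + + 4 * l * (v * v) * (X * X - + 4 * a * l) * (1ℤ + + 4 * a * l * (v * v) - u * u)
  identity = solve-∀

-- Floor plus one exceeds the quotient, so 4a A₀ > 2|b| + |D| + 1; adding 2b ≥ -2|b| leaves |D| + 1.
1+∣D∣<2f′[A₀] : ∀ a .{{_ : NonZero a}} b c →
  + suc ∣ discriminant a b c ∣ < + 2 * derivative a b (A₀ a b c)
1+∣D∣<2f′[A₀] a@(suc _) b c = begin-strict
  + suc ∣ D ∣
    ≡⟨ cong +_ (ℕ.+-comm 1 ∣ D ∣) ⟩
  + (∣ D ∣ ℕ.+ 1)
    ≤⟨ ℤ.i≤i+j _ (+ 2 * (b + + ∣ b ∣)) {{ℤ.nonNegative (ℤ.*-monoˡ-≤-nonNeg (+ 2) (0≤i+∣i∣ b))}} ⟩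
  + (∣ D ∣ ℕ.+ 1) + + 2 * (b + + ∣ b ∣)
    ≡⟨ numerator b (+ ∣ b ∣) (+ (∣ D ∣ ℕ.+ 1)) ⟩
  num + + 2 * b
    <⟨ ℤ.+-monoˡ-< (+ 2 * b) (ℤ.n<s[n/ℕd]*d num den) ⟩
  ℤ.suc (num ℤ./ℕ den) * + den + + 2 * b
    ≡⟨ cong₂ (λ q e → ℤ.suc q * e + + 2 * b) (sym (ℤ.div-pos-is-/ℕ num den))
             (trans (ℤ.pos-* 2 (2 ℕ.* a)) (cong (+ 2 *_) (ℤ.pos-* 2 a))) ⟩
  (1ℤ + num ℤ./ + den) * (+ 2 * (+ 2 * + a)) + + 2 * b
    ≡⟨ doubled (num ℤ./ + den) (+ a) b ⟩
  + 2 * derivative a b (A₀ a b c) ∎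
  where
  open ℤ.≤-Reasoning
  D   = discriminant a b c
  -- Numerator and denominator in the form in which unnormalised rational arithmetic computes them
  -- inside `A₀`.
  num = (+ ∣ b ∣ * + 2 + + (∣ D ∣ ℕ.+ 1) * + 1) * + 1
  den = 2 ℕ.* (2 ℕ.* a)
  numerator : ∀ b x y → y + + 2 * (b + x) ≡ (x * + 2 + y * + 1) * + 1 + + 2 * b
  numerator = solve-∀
  doubled : ∀ q a b → (1ℤ + q) * (+ 2 * (+ 2 * a)) + + 2 * b ≡ + 2 * (+ 2 * a * (q + 1ℤ) + b)
  doubled = solve-∀

derivative-mono : ∀ a b {x y} → x ≤ y → derivative a b x ≤ derivative a b y
derivative-mono a b {x} {y} x≤y = ℤ.+-monoˡ-≤ b
  (subst (λ e → e * x ≤ e * y) (ℤ.pos-* 2 a) (ℤ.*-monoˡ-≤-nonNeg (+ (2 ℕ.* a)) x≤y))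

-- Recurrence of the values of the sequence, and the dichotomy.

module _ (a : ℕ) .{{_ : NonZero a}} (b c : ℤ) where

  private
    D  = discriminant a b c
    s  = liouvilleSequence a b c

    x f X : ℕ → ℤ
    x k = A₀ a b c + + k
    f k = quadratic a b c (x k)
    X k = derivative a b (x k)

  1+∣D∣<2X : ∀ k → + suc ∣ D ∣ < + 2 * X k
  1+∣D∣<2X k = ℤ.<-≤-trans (1+∣D∣<2f′[A₀] a b c)
    (ℤ.*-monoˡ-≤-nonNeg (+ 2) (derivative-mono a b (ℤ.i≤i+j (A₀ a b c) (+ k))))

  X>0 : ∀ k → 0ℤ < X k
  X>0 k = ℤ.*-cancelˡ-<-nonNeg (+ 2) (ℤ.<-trans (ℤ.+<+ (s≤s z≤n)) (1+∣D∣<2X k))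

  f>0 : ∀ k → 0ℤ < f k
  f>0 k = ℤ.positive⁻¹ _ {{quadratic-positive a b c k}}

  module _ (D≢0 : D ≢ 0ℤ) (k : ℕ) where

    private
      d : ℕ
      d = 4 ℕ.* a ℕ.* ∣ f k ∣

      +d≡4af : + d ≡ + 4 * + a * f k
      +d≡4af = begin
        + d                            ≡⟨ ℤ.pos-* (4 ℕ.* a) ∣ f k ∣ ⟩
        + (4 ℕ.* a) * + ∣ f k ∣        ≡⟨ cong₂ _*_ (ℤ.pos-* 4 a) (ℤ.0≤i⇒+∣i∣≡i (ℤ.<⇒≤ (f>0 k))) ⟩
        + 4 * + a * f k                ∎
        where open ≡-Reasoning

    -- A root z would give X² - z² = D ≠ 0, hence 2X ≤ |D| + 1, against the choice of `A₀`.
    4af-nonsquare : ∀ z → z * z ≢ + d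
    4af-nonsquare z z²≡d = ℤ.<⇒≱ (1+∣D∣<2X k) (begin
      + 2 * X k         ≡⟨ ℤ.0≤i⇒+∣i∣≡i (ℤ.<⇒≤ (ℤ.<-trans (ℤ.+<+ (s≤s z≤n)) (1+∣D∣<2X k))) ⟨
      + ∣ + 2 * X k ∣   ≤⟨ ℤ.+≤+ (∣2X∣≤1+∣D∣ (X k) z D≢0 X²-z²≡D) ⟩
      + suc ∣ D ∣       ∎)
      where
      open ℤ.≤-Reasoning
      X²-z²≡D : X k * X k - z * z ≡ D
      X²-z²≡D = trans (cong (λ w → X k * X k - w) (trans z²≡d +d≡4af)) (derivative²-4af≡D a b c (x k))

    -- The Pell solution for 4a f(n) supplies the unit; t > 0 because f(n), X, u and v are all
    -- positive.
    square-multiple : ∃₂ λ t m → 0ℤ < t × quadratic a b c (x k + t) ≡ f k * (m * m)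
    square-multiple =
      let u , v , u>0 , v>0 , unit = Pell.pell d 4af-nonsquare
          t = + 4 * f k * v * (v * X k + u)
          4fv>0 = 0<i*j (0<i*j (ℤ.positive⁻¹ (+ 4)) (f>0 k)) v>0
          vX+u>0 = ℤ.+-mono-< (0<i*j v>0 (X>0 k)) u>0
      in t , 1ℤ + + 2 * v * (u * X k + + 4 * + a * f k * v) , 0<i*j 4fv>0 vX+u>0 ,
         trans (quadratic-translate a b c (x k) t)
               (translate-by-unit (+ a) (f k) (X k) u v
                 (trans unit (cong (λ w → 1ℤ + w * (v * v)) +d≡4af)))

    later-equal-value : ∃[ k′ ] k ℕ.< k′ × s k′ ≡ s k
    later-equal-value = from-multiple square-multiple
      where
      from-multiple : (∃₂ λ t m → 0ℤ < t × quadratic a b c (x k + t) ≡ f k * (m * m)) →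
        ∃[ k′ ] k ℕ.< k′ × s k′ ≡ s k
      from-multiple (t , m , t>0 , f[x+t]≡fm²) =
        k ℕ.+ ∣ t ∣ , ℕ.m<m+n k (ℤ.drop‿+<+ (subst (0ℤ <_) (sym +∣t∣≡t) t>0)) ,
        trans (liouville-cong {{quadratic-positive a b c (k ℕ.+ ∣ t ∣)}} {{fm²>0}} f[k+t]≡fm²)
              (liouville-square (f k) m {{quadratic-positive a b c k}} {{fm²>0}})
        where
        +∣t∣≡t : + ∣ t ∣ ≡ t
        +∣t∣≡t = ℤ.0≤i⇒+∣i∣≡i (ℤ.<⇒≤ t>0)

        f[k+t]≡fm² : f (k ℕ.+ ∣ t ∣) ≡ f k * (m * m)
        f[k+t]≡fm² = trans
          (cong (quadratic a b c) (trans (sym (ℤ.+-assoc (A₀ a b c) (+ k) (+ ∣ t ∣)))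
                                         (cong (λ w → x k + w) +∣t∣≡t)))
          f[x+t]≡fm²

        fm²>0 : Positive (f k * (m * m))
        fm²>0 = positive (subst (0ℤ <_) f[k+t]≡fm² (f>0 (k ℕ.+ ∣ t ∣)))

  -- Each passage to a later equal value raises the index by at least one, so N passages reach N.
  value-infinitely-often : D ≢ 0ℤ → ∀ k → InfinitelyOften (s k) s
  value-infinitely-often D≢0 k zero    = k , z≤n , refl
  value-infinitely-often D≢0 k (suc N) =
    let k′ , N≤k′ , s≡  = value-infinitely-often D≢0 k N
        k″ , k′<k″ , s≡′ = later-equal-value D≢0 k′
    in k″ , ℕ.≤-<-trans N≤k′ k′<k″ , trans s≡′ s≡

  4a>0 : 0ℤ < + 4 * + a
  4a>0 = 0<i*j (ℤ.positive⁻¹ (+ 4)) (ℤ.+<+ (ℕ.>-nonZero⁻¹ a))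

  -- Now 4a f = X², so f (4a)² = 4a X²; removing the square factors on both sides gives λ(f) =
  -- λ(4a).
  zero-discriminant⇒constant : D ≡ 0ℤ → Constant s
  zero-discriminant⇒constant D≡0 = liouville (+ 4 * + a) {{positive 4a>0}} , λ k →
    let open ≡-Reasoning
        4aX²≡f[4a]² : + 4 * + a * (X k * X k) ≡ f k * (+ 4 * + a * (+ 4 * + a))
        4aX²≡f[4a]² = begin
          + 4 * + a * (X k * X k)
            ≡⟨ expand (+ a) (X k) (f k) ⟩
          f k * (+ 4 * + a * (+ 4 * + a)) + + 4 * + a * (X k * X k - + 4 * + a * f k)
            ≡⟨ cong (λ w → f k * (+ 4 * + a * (+ 4 * + a)) + + 4 * + a * w)
                    (trans (derivative²-4af≡D a b c (x k)) D≡0) ⟩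
          f k * (+ 4 * + a * (+ 4 * + a)) + + 4 * + a * 0ℤ
            ≡⟨ drop (f k * (+ 4 * + a * (+ 4 * + a))) (+ a) ⟩
          f k * (+ 4 * + a * (+ 4 * + a)) ∎
        4aX²>0   = positive (0<i*j 4a>0 (0<i*j (X>0 k) (X>0 k)))
        f[4a]²>0 = positive (0<i*j (f>0 k) (0<i*j 4a>0 4a>0))
    in begin
      s k
        ≡⟨ liouville-square (f k) (+ 4 * + a) {{quadratic-positive a b c k}} {{f[4a]²>0}} ⟨
      liouville (f k * (+ 4 * + a * (+ 4 * + a))) {{f[4a]²>0}}
        ≡⟨ liouville-cong {{f[4a]²>0}} {{4aX²>0}} (sym 4aX²≡f[4a]²) ⟩
      liouville (+ 4 * + a * (X k * X k)) {{4aX²>0}}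
        ≡⟨ liouville-square (+ 4 * + a) (X k) {{positive 4a>0}} {{4aX²>0}} ⟩
      liouville (+ 4 * + a) {{positive 4a>0}} ∎
    where
    expand : ∀ a X f → + 4 * a * (X * X) ≡ f * (+ 4 * a * (+ 4 * a)) + + 4 * a * (X * X - + 4 * a * f)
    expand = solve-∀
    drop : ∀ y a → y + + 4 * a * 0ℤ ≡ y
    drop = solve-∀

  liouvilleSequence≡±1 : ∀ k → s k ≡ 1ℤ ⊎ s k ≡ -1ℤ
  liouvilleSequence≡±1 k = liouville≡±1 (f k) {{quadratic-positive a b c k}}

  two-values⇒changes : D ≢ 0ℤ → ∀ k → s k ≢ s 0 → ChangesSignInfinitelyOften s
  two-values⇒changes D≢0 k s≢ with liouvilleSequence≡±1 k | liouvilleSequence≡±1 0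
  ... | inj₁ sk | inj₁ s0 = contradiction (trans sk (sym s0)) s≢
  ... | inj₂ sk | inj₂ s0 = contradiction (trans sk (sym s0)) s≢
  ... | inj₁ sk | inj₂ s0 = subst (λ v → InfinitelyOften v s) sk (value-infinitely-often D≢0 k) ,
                            subst (λ v → InfinitelyOften v s) s0 (value-infinitely-often D≢0 0)
  ... | inj₂ sk | inj₁ s0 = subst (λ v → InfinitelyOften v s) s0 (value-infinitely-often D≢0 0) ,
                            subst (λ v → InfinitelyOften v s) sk (value-infinitely-often D≢0 k)

theorem2p3 : ExcludedMiddle 0ℓ →
    (a : ℕ) .{{_ : NonZero a}} (b c : ℤ) →
    Constant (liouvilleSequence a b c) ⊎ ChangesSignInfinitelyOften (liouvilleSequence a b c)
theorem2p3 em a b c with discriminant a b c ℤ.≟ 0ℤ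
... | yes D≡0 = inj₁ (zero-discriminant⇒constant a b c D≡0)
-- Excluded middle decides whether some term differs from the first one, a search over infinitely
-- many indices.
... | no D≢0 with em {∃[ k ] liouvilleSequence a b c k ≢ liouvilleSequence a b c 0}
...   | yes (k , s≢) = inj₂ (two-values⇒changes a b c D≢0 k s≢)
...   | no ∄k        = inj₁ (-, λ k → decidable-stable (_ ℤ.≟ _) λ s≢ → ∄k (k , s≢))
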